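{- Assume that $q$ is even. The number of good sets equals $$|\mathcal{I}|^{q+1}(q+1)!=\left(\frac{q-2}{2}\right)^{q+1}(q+1)!.$$
   Context: Let $q\ge4$ be a power of $2$. Let $\Lambda\subset\mathbb{F}_{q^2}\setminus\{0\}$ be a fixed set of $q-1$ elements with pairwise distinct norms $\alpha^{q+1}$, and $\mathcal{U}=\{u\in\mathbb{F}_{q^2}:u^{q+1}=1\}$. Fix $A=\{a_1,\dots,a_{(q-2)/2}\}\subset\mathbb{F}_q\setminus\{0\}$ such that $\{1\}\cup A\cup A^{ -1}=\mathbb{F}_q\setminus\{0\}$ is a partition, where $A^{ -1}=\{a^{ -1}:a\in A\}$, and put $\mathcal{I}=\{\alpha\in\Lambda:\alpha^{q+1}\in A\}$, so $|\mathcal{I}|=(q-2)/2$. For $\alpha\in\mathcal{I}$, $u,v\in\mathcal{U}$, $P_{\alpha u}=(1,0,\alpha u,0)$ is a point of $\mathrm{PG}(3,q^2)$ and $\pi_{\alpha v}$ is the plane $X_4=\alpha vX_2$. A good set is a set $\mathcal{P}$ of $q+1$ pairs $(P_{\alpha_iu_i},\pi_{\alpha_iv_i})$, $\alpha_i\in\mathcal{I}$, $u_i,v_i\in\mathcal{U}$, such that any two members with $(\alpha_i,u_i,v_i)\ne(\alpha_j,u_j,v_j)$ satisfy $u_iv_j-v_iu_j\neq0$ and $\alpha_iu_i(\alpha_jv_j)^q-(\alpha_iv_i)^q\alpha_ju_j\neq0$. Equivalently, since the triple $(\alpha,u,v)$ is determined by the pair $(P_{\alpha u},\pi_{\alpha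 v})$, good sets may be counted as sets of $q+1$ triples. -}

module Defs where

open import Algebra.Apartness.Bundles using (HeytingField)
open import Algebra.Bundles using (CommutativeRing)
import Algebra.Apartness.Properties.HeytingCommutativeRing as HCRProperties
import Algebra.Properties.Semiring.Exp as SemiringExp
open import Data.Fin.Base using (Fin)
open import Data.Fin.Patterns using (0F; 3F)
open import Data.Nat.Base using (ℕ; suc; _∸_; _/_)
open import Data.Product.Base using (Σ; ∃-syntax; Σ-syntax; _×_; _,_; proj₁; proj₂)
open import Data.Product.Relation.Binary.Pointwise.NonDependent using (×-setoid)
open import Data.Sum.Base using (_⊎_)
open import Data.Vec.Functional using (Vector; _∷_; [])
open import Function.Bundles using (Inverse; _⇔_)
open import Level as L using (Level; _⊔_)
open import Relation.Binary.Bundles using (Setoid)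
open import Relation.Binary.Definitions using (_Respects_)
open import Relation.Nullary.Negation using (¬_)
open import Relation.Unary using (Pred; _∈_; _∉_)
import Relation.Binary.Construct.On as On
import Relation.Binary.PropositionalEquality.Properties as ≡
open import Relation.Unary.Relation.Binary.Equality using (≐-setoid)

private variable
  a ℓ p r : Level

HasSize : Setoid a ℓ → ℕ → Set (a ⊔ ℓ)
HasSize S n = Inverse S (≡.setoid (Fin n))

-- Membership is not required to be decidable: for a set of known finite size
-- inside a finite setoid it is decidable automatically, by enumeration.
record Subset (S : Setoid a ℓ) (p : Level) : Set (a ⊔ ℓ ⊔ L.suc p) where
  open Setoid S
  field
    members  : Pred Carrier p
    respects : members Respects _≈_

open Subset public

infix 5 _∣_
_∣_ : (S : Setoid a ℓ) → Pred (Setoid.Carrier S) p → Setoid (a ⊔ p) ℓ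
S ∣ P = On.setoid {B = Σ (Setoid.Carrier S) P} S proj₁

-- In a Heyting field with finitely many elements, invertibility is decidable by
-- search, so _#_ is decidable and coincides with ¬ x ≈ y: finite Heyting fields
-- are exactly finite fields, and "x ≠ y" is rendered as x # y.
-- The definitions are meant for K with q ^ 2 elements, i.e. K = 𝔽_{q²}.
module GoodSets {c ℓ₁ ℓ₂} (K : HeytingField c ℓ₁ ℓ₂) (q : ℕ) where

  open HeytingField K using (_#_; #⇒invertible; #-sym; heytingCommutativeRing)
  open HCRProperties heytingCommutativeRing

  private
    R : CommutativeRing c ℓ₁
    R = record { isCommutativeRing = HeytingField.isCommutativeRing K }

  open CommutativeRing R
  open SemiringExp semiring using (_^_)

  𝕂 : Setoid c ℓ₁
  𝕂 = setoid

  norm : Carrier → Carrier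
  norm x = x ^ suc q

  -- 𝔽_q is the subfield of 𝔽_{q²} fixed by x ↦ x ^ q.
  𝔽q∖0 : Pred Carrier (ℓ₁ ⊔ ℓ₂)
  𝔽q∖0 x = x ^ q ≈ x × x # 0#

  𝒰 : Pred Carrier ℓ₁
  𝒰 u = u ^ suc q ≈ 1#

  Inverses : Pred Carrier p → Pred Carrier (c ⊔ ℓ₁ ⊔ p)
  Inverses A x = ∃[ a ] a ∈ A × x * a ≈ 1#

  record IsNormSystem (Λ : Pred Carrier p) : Set (c ⊔ ℓ₁ ⊔ ℓ₂ ⊔ p) where
    field
      size           : HasSize (𝕂 ∣ Λ) (q ∸ 1)
      nonzero        : ∀ {α} → α ∈ Λ → α # 0#
      distinct-norms : ∀ {α β} → α ∈ Λ → β ∈ Λ → α # β → norm α # norm β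

  -- {1}, A, A⁻¹ partition 𝔽_q ∖ {0}.
  record IsHalfSystem (A : Pred Carrier p) : Set (c ⊔ ℓ₁ ⊔ ℓ₂ ⊔ p) where
    field
      size    : HasSize (𝕂 ∣ A) ((q ∸ 2) / 2)
      union   : ∀ x → (x ≈ 1# ⊎ x ∈ A ⊎ x ∈ Inverses A) ⇔ x ∈ 𝔽q∖0
      1∉A     : 1# ∉ A
      1∉A⁻¹   : 1# ∉ Inverses A
      A∩A⁻¹≡∅ : ∀ {x} → x ∈ A → x ∉ Inverses A

  ℐ : Pred Carrier p → Pred Carrier r → Pred Carrier (p ⊔ r)
  ℐ Λ A α = α ∈ Λ × norm α ∈ A

  -- Homogeneous coordinates: nonzero vectors of K⁴ up to a nonzero scalar.
  Homogeneous : Setoid (c ⊔ ℓ₂) (c ⊔ ℓ₁ ⊔ ℓ₂)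
  Homogeneous = record
    { Carrier       = Σ[ x ∈ Vector Carrier 4 ] ∃[ i ] x i # 0#
    ; _≈_           = λ x y → proj₁ x ~ proj₁ y
    ; isEquivalence = record { refl = ~-refl ; sym = ~-sym ; trans = ~-trans }
    }
    where
    _~_ : Vector Carrier 4 → Vector Carrier 4 → Set (c ⊔ ℓ₁ ⊔ ℓ₂)
    x ~ y = ∃[ k ] k # 0# × (∀ i → x i ≈ k * y i)

    ~-refl : ∀ {x} → x ~ x
    ~-refl = 1# , 1#0 , λ i → sym (*-identityˡ _)

    ~-sym : ∀ {x y} → x ~ y → y ~ x
    ~-sym {_} {y} (k , k#0 , x≈ky) with #⇒invertible k#0
    ... | k⁻¹ , k⁻¹[k-0]≈1 , [k-0]k⁻¹≈1 =
      k⁻¹ , invertibleˡ⇒# (k , trans (*-congˡ (x-0≈x k⁻¹)) kk⁻¹≈1) , λ i →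
        trans (sym (*-identityˡ (y i)))
          (trans (*-congʳ (sym (trans (*-comm k⁻¹ k) kk⁻¹≈1)))
            (trans (*-assoc k⁻¹ k (y i)) (*-congˡ (sym (x≈ky i)))))
      where
      kk⁻¹≈1 : k * k⁻¹ ≈ 1#
      kk⁻¹≈1 = trans (*-congʳ (sym (x-0≈x k))) [k-0]k⁻¹≈1

    ~-trans : ∀ {x y z} → x ~ y → y ~ z → x ~ z
    ~-trans (k , k#0 , x≈ky) (l , l#0 , y≈lz) =
      k * l , x#0y#0→xy#0 k#0 l#0 , λ i →
        trans (x≈ky i) (trans (*-congˡ (y≈lz i)) (sym (*-assoc k l _)))

  Point : Setoid (c ⊔ ℓ₂) (c ⊔ ℓ₁ ⊔ ℓ₂)
  Point = Homogeneous

  -- (h₁ , h₂ , h₃ , h₄) stands for the plane h₁X₁ + h₂X₂ + h₃X₃ + h₄X₄ = 0.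
  Plane : Setoid (c ⊔ ℓ₂) (c ⊔ ℓ₁ ⊔ ℓ₂)
  Plane = Homogeneous

  P : Carrier → Setoid.Carrier Point
  P x = (1# ∷ 0# ∷ x ∷ 0# ∷ []) , 0F , 1#0

  -- X₄ = y X₂
  π : Carrier → Setoid.Carrier Plane
  π y = (0# ∷ - y ∷ 0# ∷ 1# ∷ []) , 3F , 1#0

  Pair : Setoid (c ⊔ ℓ₂) (c ⊔ ℓ₁ ⊔ ℓ₂)
  Pair = ×-setoid Point Plane

  pair : (α u v : Carrier) → Setoid.Carrier Pair
  pair α u v = P (α * u) , π (α * v)

  record GoodSet (Λ : Pred Carrier p) (A : Pred Carrier r) :
                 Set (L.suc (c ⊔ ℓ₁ ⊔ ℓ₂) ⊔ p ⊔ r) where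
    open Setoid Pair using () renaming (_≈_ to _≈ₚ_)
    field
      pairs : Subset Pair (c ⊔ ℓ₁ ⊔ ℓ₂)
      size  : HasSize (Pair ∣ members pairs) (suc q)
      shape : ∀ {x} → x ∈ members pairs →
              ∃[ α ] ∃[ u ] ∃[ v ] α ∈ ℐ Λ A × u ∈ 𝒰 × v ∈ 𝒰 × x ≈ₚ pair α u v
      good  : ∀ {αᵢ uᵢ vᵢ αⱼ uⱼ vⱼ} →
              αᵢ ∈ ℐ Λ A → uᵢ ∈ 𝒰 → vᵢ ∈ 𝒰 →
              αⱼ ∈ ℐ Λ A → uⱼ ∈ 𝒰 → vⱼ ∈ 𝒰 →
              pair αᵢ uᵢ vᵢ ∈ members pairs →
              pair αⱼ uⱼ vⱼ ∈ members pairs →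
              ¬ (αᵢ ≈ αⱼ × uᵢ ≈ uⱼ × vᵢ ≈ vⱼ) →
              (uᵢ * vⱼ - vᵢ * uⱼ) # 0# ×
              (αᵢ * uᵢ * (αⱼ * vⱼ) ^ q - (αᵢ * vᵢ) ^ q * (αⱼ * uⱼ)) # 0#

  -- Good sets are equal when they have the same members.
  GoodSetSetoid : (Λ : Pred Carrier p) (A : Pred Carrier r) →
                  Setoid (L.suc (c ⊔ ℓ₁ ⊔ ℓ₂) ⊔ p ⊔ r) (c ⊔ ℓ₁ ⊔ ℓ₂)
  GoodSetSetoid Λ A =
    On.setoid {B = GoodSet Λ A}
      (≐-setoid (Setoid.Carrier Pair) (c ⊔ ℓ₁ ⊔ ℓ₂)) (λ G → members (GoodSet.pairs G))

{-# OPTIONS --safe #-}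

-- For α ∈ ℐ put ω = α ^ (q ∸ 1), an element of 𝒰. Since v ^ q is the inverse of v
-- for v ∈ 𝒰, the two goodness conditions on a pair of triples (α , u , v) say exactly
-- that their ratios t = u / v differ and that their twists s = u v / ω differ. As
-- u² = t s ω and squaring is invertible on 𝒰, whose order q + 1 is odd, (α , t , s)
-- is a free system of coordinates on ℐ × 𝒰 × 𝒰. Because |𝒰| = q + 1, a good set meets
-- every t and every s exactly once: it is the graph of t ↦ (s , α) for a unique
-- permutation of 𝒰 and a unique function 𝒰 → ℐ.
--
-- The sizes of 𝒰 and ℐ come from counting alone: the half system shows that
-- 𝔽_q ∖ {0} has at most q - 1 elements, so the norm maps Λ bijectively onto it, whence
-- multiplication Λ × 𝒰 → 𝔽_{q²} ∖ {0} is a bijection.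
module Submission where

open import Defs
open import Algebra.Apartness.Bundles using (HeytingField)
open import Algebra.Bundles using (CommutativeRing)
import Algebra.Apartness.Properties.HeytingCommutativeRing as HCRProperties
import Algebra.Properties.CommutativeMonoid.Sum as Sum
import Algebra.Properties.CommutativeSemiring.Exp as Exp
import Algebra.Properties.Group as GroupProperties
import Algebra.Solver.CommutativeMonoid as CommutativeMonoidSolver
open import Data.Fin.Base as Fin using (Fin; zero; suc; punchIn; punchOut; finToFun; funToFin)
open import Data.Fin.Patterns using (0F; 1F; 2F; 3F)
open import Data.Fin.Permutation as Perm using (Permutation; _⟨$⟩ʳ_; _⟨$⟩ˡ_)
import Data.Fin.Properties as Fin
open import Data.Nat.Base as ℕ using (ℕ; zero; suc; _≤_; s≤s; _∸_; _/_; _!)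
import Data.Nat.DivMod as ℕ
import Data.Nat.Properties as ℕ
open import Data.Nat.Solver using (module +-*-Solver)
open import Data.Product.Base as Product using (∃; ∃-syntax; Σ; _×_; _,_; proj₁; proj₂)
open import Data.Product.Function.NonDependent.Setoid using (_×-inverse_)
open import Data.Product.Relation.Binary.Pointwise.NonDependent using (_×ₛ_; Pointwise-≡↔≡)
open import Data.Sum.Base using (_⊎_; inj₁; inj₂; map₂)
open import Data.Sum.Properties using (inj₁-injective; inj₂-injective)
open import Function.Base using (_∘_; id)
open import Function.Bundles using (Inverse; Equivalence; _⇔_; mk⇔)
import Function.Construct.Composition as Comp
import Function.Construct.Identity as Id
import Function.Construct.Symmetry as Symm
open import Function.Definitions using (Injective; Congruent; StrictlyInverseˡ; StrictlyInverseʳ)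
open import Level as L using (Level; 0ℓ)
open import Relation.Binary.Bundles using (Setoid)
open import Relation.Binary.Definitions using (_Respects_) renaming (Decidable to Decidable₂)
open import Relation.Binary.PropositionalEquality as ≡ using (_≡_; _≢_; _≗_; module ≡-Reasoning; _→-setoid_)
import Relation.Binary.Reasoning.Setoid as ≈-Reasoning
open import Relation.Nullary.Decidable using (Dec; yes; no; map′; decidable-stable)
open import Relation.Nullary.Negation using (¬_; contradiction)
open import Relation.Unary using (Pred; Decidable; _∈_; _⊆_; _≐_)

private variable
  a b ℓ ℓ₁ ℓ₂ p : Level
  m n : ℕ

-- Finite setoids

mkInverse : {S : Setoid a ℓ₁} {T : Setoid b ℓ₂} →
            let module S = Setoid S ; module T = Setoid T in
            (to : S.Carrier → T.Carrier) (from : T.Carrier → S.Carrier) →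
            Congruent S._≈_ T._≈_ to → Congruent T._≈_ S._≈_ from →
            StrictlyInverseˡ T._≈_ to from → StrictlyInverseʳ S._≈_ to from →
            Inverse S T
mkInverse {S = S} {T = T} to from to-cong from-cong invˡ invʳ = record
  { to        = to
  ; from      = from
  ; to-cong   = to-cong
  ; from-cong = from-cong
  ; inverse   = (λ y≈ → T.trans (to-cong y≈) (invˡ _))
              , (λ x≈ → S.trans (from-cong x≈) (invʳ _))
  }
  where
  module S = Setoid S
  module T = Setoid T

-- The inverse map takes the preimages supplied by surjectivity. These may depend on the
-- representative of `y`, and injectivity of `f` makes the choice congruent.
bijective⇒Inverse : {S : Setoid a ℓ₁} {T : Setoid b ℓ₂} →
                    let module S = Setoid S ; module T = Setoid T in
                    (f : S.Carrier → T.Carrier) → Congruent S._≈_ T._≈_ f → Injective S._≈_ T._≈_ f →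
                    (∀ y → ∃[ x ] f x T.≈ y) → Inverse S T
bijective⇒Inverse {T = T} f f-cong f-inj surj = mkInverse f (proj₁ ∘ surj) f-cong
  (λ {y} {z} y≈z → f-inj (T.trans (proj₂ (surj y)) (T.trans y≈z (T.sym (proj₂ (surj z))))))
  (proj₂ ∘ surj)
  (λ x → f-inj (proj₂ (surj (f x))))
  where module T = Setoid T

module _ {S : Setoid a ℓ} where
  open Setoid S using (Carrier; _≈_)

  size-unique : HasSize S m → HasSize S n → m ≡ n
  size-unique e f = Perm.↔⇒≡ (Comp.inverse (Symm.inverse e) f)

  size-resp : {T : Setoid b ℓ₂} → Inverse T S → HasSize S n → HasSize T n
  size-resp = Comp.inverse

  module Enumeration (e : HasSize S n) where
    open Inverse e public using () renaming (to to index; from to element; to-cong to index-cong)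

    element-index : ∀ x → element (index x) ≈ x
    element-index x = Inverse.inverseʳ e ≡.refl

    index-element : ∀ i → index (element i) ≡ i
    index-element i = Inverse.inverseˡ e (Setoid.refl S)

    index-injective : ∀ {x y} → index x ≡ index y → x ≈ y
    index-injective {x} {y} eq = Setoid.trans S (Setoid.sym S (Inverse.inverseʳ e (≡.sym eq))) (element-index y)

    element-injective : ∀ {i j} → element i ≈ element j → i ≡ j
    element-injective eq = ≡.trans (≡.sym (index-element _)) (≡.trans (index-cong eq) (index-element _))

    ≈-dec : Decidable₂ _≈_
    ≈-dec x y = map′ index-injective index-cong (index x Fin.≟ index y)

    search : {P : Pred Carrier p} → P Respects _≈_ → Decidable P → Dec (∃ P)
    search resp P? = map′ (λ (i , Pi) → element i , Pi)
                          (λ (x , Px) → index x , resp (Setoid.sym S (element-index x)) Px)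
                          (Fin.any? (P? ∘ element))

size-≢ : (i : Fin (suc n)) → HasSize (≡.setoid (Fin (suc n)) ∣ (_≢ i)) n
size-≢ i = mkInverse
  (λ (j , j≢i) → punchOut (j≢i ∘ ≡.sym))
  (λ j → punchIn i j , Fin.punchInᵢ≢i i j)
  (Fin.punchOut-cong i)
  (≡.cong (punchIn i))
  (λ j → ≡.trans (Fin.punchOut-cong i ≡.refl) (Fin.punchOut-punchIn i))
  (λ (j , j≢i) → Fin.punchIn-punchOut (j≢i ∘ ≡.sym))

-- Induction on `n`, keeping or dropping `0F`. Equality in the subset ignores the proofs of `P`, so
-- each index counts once however many proofs it has. This is what gives `𝒰` some size before its
-- value is known.
size-filter-Fin : {P : Pred (Fin n) p} → Decidable P → ∃[ k ] HasSize (≡.setoid (Fin n) ∣ P) k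
size-filter-Fin {zero} P? = 0 , mkInverse (λ ()) (λ ()) (λ { {()} }) (λ { {()} }) (λ ()) (λ ())
size-filter-Fin {suc n} {P = P} P? with size-filter-Fin (P? ∘ suc) | P? 0F
... | k , e | yes P0 = suc k , mkInverse to from (λ {x} → to-cong {x}) (λ { ≡.refl → ≡.refl }) invˡ invʳ
  where
  open Enumeration e
  to : Σ (Fin (suc n)) P → Fin (suc k)
  to (0F    , _)  = 0F
  to (suc i , Pi) = suc (index (i , Pi))
  from : Fin (suc k) → Σ (Fin (suc n)) P
  from 0F      = 0F , P0
  from (suc j) = Product.map suc id (element j)
  to-cong : ∀ {x y} → proj₁ x ≡ proj₁ y → to x ≡ to y
  to-cong {0F , _} {0F , _} _ = ≡.refl
  to-cong {suc i , _} {suc j , _} eq = ≡.cong suc (index-cong (Fin.suc-injective eq))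
  invˡ : ∀ j → to (from j) ≡ j
  invˡ 0F      = ≡.refl
  invˡ (suc j) = ≡.cong suc (index-element j)
  invʳ : ∀ x → proj₁ (from (to x)) ≡ proj₁ x
  invʳ (0F , _)    = ≡.refl
  invʳ (suc i , _) = ≡.cong suc (element-index _)
... | k , e | no ¬P0 = k , mkInverse to from (λ {x} → to-cong {x}) (λ { ≡.refl → ≡.refl }) index-element invʳ
  where
  open Enumeration e
  to : Σ (Fin (suc n)) P → Fin k
  to (0F    , P0) = contradiction P0 ¬P0
  to (suc i , Pi) = index (i , Pi)
  from : Fin k → Σ (Fin (suc n)) P
  from j = Product.map suc id (element j)
  to-cong : ∀ {x y} → proj₁ x ≡ proj₁ y → to x ≡ to y
  to-cong {0F , P0} _ = contradiction P0 ¬P0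
  to-cong {suc i , _} {suc j , _} eq = index-cong (Fin.suc-injective eq)
  invʳ : ∀ x → proj₁ (from (to x)) ≡ proj₁ x
  invʳ (0F , P0)   = contradiction P0 ¬P0
  invʳ (suc i , _) = ≡.cong suc (element-index _)

module _ {S : Setoid a ℓ} (e : HasSize S n) where
  open Setoid S using (Carrier; _≈_)
  open Enumeration e

  reindex : {P : Pred Carrier p} → P Respects _≈_ → Inverse (S ∣ P) (≡.setoid (Fin n) ∣ (P ∘ element))
  reindex resp = mkInverse
    (λ (x , Px) → index x , resp (Setoid.sym S (element-index x)) Px)
    (λ (i , Pi) → element i , Pi)
    index-cong (Inverse.from-cong e)
    (index-element ∘ proj₁) (element-index ∘ proj₁)

  size-filter : {P : Pred Carrier p} → P Respects _≈_ → Decidable P → ∃[ k ] HasSize (S ∣ P) k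
  size-filter resp P? with size-filter-Fin (P? ∘ element)
  ... | k , f = k , size-resp (reindex resp) f

size-without : {S : Setoid a ℓ} → HasSize S (suc n) → (x : Setoid.Carrier S) →
               HasSize (S ∣ (λ y → ¬ Setoid._≈_ S y x)) n
size-without {S = S} e x = size-resp (mkInverse
  (λ (y , y≉x) → index y , y≉x ∘ index-injective)
  (λ (i , i≢x) → element i , λ i≈x → i≢x (≡.trans (≡.sym (index-element i)) (index-cong i≈x)))
  index-cong (Inverse.from-cong e)
  (index-element ∘ proj₁) (element-index ∘ proj₁))
  (size-≢ (index x))
  where open Enumeration e

size-× : {S : Setoid a ℓ₁} {T : Setoid b ℓ₂} → HasSize S m → HasSize T n → HasSize (S ×ₛ T) (m ℕ.* n)
size-× e f = Comp.inverse (e ×-inverse f) (Comp.inverse Pointwise-≡↔≡ (Symm.inverse Fin.*↔×))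

size-→ : ∀ m n → HasSize (Fin m →-setoid Fin n) (n ℕ.^ m)
size-→ m n = mkInverse funToFin finToFun (funToFin-cong m) (λ { ≡.refl _ → ≡.refl })
  (Fin.funToFin-finToFin {m} {n}) Fin.finToFun-funToFin
  where
  -- Functions are compared pointwise here, so congruence goes by induction on the domain.
  funToFin-cong : ∀ m {f g : Fin m → Fin n} → f ≗ g → funToFin f ≡ funToFin g
  funToFin-cong zero    f≗g = ≡.refl
  funToFin-cong (suc m) f≗g = ≡.cong₂ Fin.combine (f≗g 0F) (funToFin-cong m (f≗g ∘ suc))

-- Counting permutations, and the pigeonhole principle

Permutations : ℕ → Setoid 0ℓ 0ℓ
Permutations n = record
  { Carrier       = Permutation n n
  ; _≈_           = Perm._≈_
  ; isEquivalence = record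
    { refl  = λ _ → ≡.refl
    ; sym   = λ eq i → ≡.sym (eq i)
    ; trans = λ eq₁ eq₂ i → ≡.trans (eq₁ i) (eq₂ i)
    }
  }

-- A permutation of n + 1 points amounts to the image of `0F` and the permutation of n points left
-- after deleting `0F` and its image, which is the recursion of the factorial.
size-Permutations : ∀ n → HasSize (Permutations n) (n !)
size-Permutations zero = mkInverse (λ _ → 0F) (λ _ → Perm.id) (λ _ → ≡.refl) (λ _ ()) (λ { 0F → ≡.refl }) (λ _ ())
size-Permutations (suc n) = Comp.inverse
  (mkInverse
    (λ π → π ⟨$⟩ʳ 0F , Perm.remove 0F π)
    (λ (j , π) → Perm.insert 0F j π)
    (λ {π} {ρ} → remove-cong {π} {ρ})
    (λ { {i , π} {.i , ρ} (≡.refl , π≈ρ) → insert-cong i {π} {ρ} π≈ρ })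
    (λ (j , π) → ≡.refl , Perm.remove-insert 0F j π)
    (Perm.insert-remove 0F))
  (size-× (Id.inverse (≡.setoid (Fin (suc n)))) (size-Permutations n))
  where
  remove-cong : ∀ {π ρ : Permutation (suc n) (suc n)} → π Perm.≈ ρ →
                (π ⟨$⟩ʳ 0F ≡ ρ ⟨$⟩ʳ 0F) × (Perm.remove 0F π Perm.≈ Perm.remove 0F ρ)
  -- Reinserting the deleted value by `punchIn` gives back the original permutation at `suc j`, and
  -- `punchIn` is injective.
  remove-cong {π} {ρ} π≈ρ = π≈ρ 0F , λ j → Fin.punchIn-injective (π ⟨$⟩ʳ 0F) _ _ (begin
    punchIn (π ⟨$⟩ʳ 0F) (Perm.remove 0F π ⟨$⟩ʳ j)  ≡⟨ Perm.punchIn-permute π 0F j ⟨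
    π ⟨$⟩ʳ suc j                                   ≡⟨ π≈ρ (suc j) ⟩
    ρ ⟨$⟩ʳ suc j                                   ≡⟨ Perm.punchIn-permute ρ 0F j ⟩
    punchIn (ρ ⟨$⟩ʳ 0F) (Perm.remove 0F ρ ⟨$⟩ʳ j)  ≡⟨ ≡.cong (λ i → punchIn i _) (π≈ρ 0F) ⟨
    punchIn (π ⟨$⟩ʳ 0F) (Perm.remove 0F ρ ⟨$⟩ʳ j)  ∎)
    where open ≡-Reasoning
  insert-cong : ∀ i {π ρ : Permutation n n} → π Perm.≈ ρ → Perm.insert 0F i π Perm.≈ Perm.insert 0F i ρ
  insert-cong i π≈ρ 0F      = ≡.refl
  insert-cong i π≈ρ (suc j) = ≡.cong (punchIn i) (π≈ρ j)

-- If `y` were missed, punching it out of the codomain would give an injection from n + 1 points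
-- into n points.
injective⇒surjective : {f : Fin n → Fin n} → Injective _≡_ _≡_ f → ∀ y → ∃[ x ] f x ≡ y
injective⇒surjective {suc n} {f} inj y with Fin.any? (λ x → f x Fin.≟ y)
... | yes found = found
... | no ¬found = contradiction
  (Fin.injective⇒≤ (inj ∘ Fin.punchOut-injective (y≢f _) (y≢f _)))
  (ℕ.<⇒≱ (ℕ.n<1+n n))
  where
  y≢f : ∀ x → y ≢ f x
  y≢f x y≡fx = ¬found (x , ≡.sym y≡fx)

injective⇒permutation : (f : Fin n → Fin n) → Injective _≡_ _≡_ f → Permutation n n
injective⇒permutation f inj = Perm.permutation f (proj₁ ∘ surj) (proj₂ ∘ surj) (λ x → inj (proj₂ (surj (f x))))
  where surj = injective⇒surjective inj

-- Subsets of a three-parameter family that are graphs over the first parameter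
module Graphs (X : Setoid a ℓ) (D : Fin m → Fin m → Fin n → Setoid.Carrier X)
  (D-injective : ∀ {t s i t′ s′ i′} → Setoid._≈_ X (D t s i) (D t′ s′ i′) → t ≡ t′ × s ≡ s′ × i ≡ i′)
  where
  private module X = Setoid X
  open X using (_≈_)

  D-cong : ∀ {t s i t′ s′ i′} → t ≡ t′ → s ≡ s′ → i ≡ i′ → D t s i ≈ D t′ s′ i′
  D-cong ≡.refl ≡.refl ≡.refl = X.refl

  -- The function gives the third parameter and the permutation the second, both in terms of the
  -- first. In this order the count reads n ^ m times m factorial.
  Codes : Setoid 0ℓ 0ℓ
  Codes = (Fin m →-setoid Fin n) ×ₛ Permutations m

  Code : Set
  Code = Setoid.Carrier Codes

  point : Code → Fin m → X.Carrier
  point (f , σ) t = D t (σ ⟨$⟩ʳ t) (f t)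

  Graph : Code → Pred X.Carrier ℓ
  Graph γ x = ∃[ t ] x ≈ point γ t

  Graph-resp : ∀ γ → Graph γ Respects _≈_
  Graph-resp γ x≈y (t , x≈) = t , X.trans (X.sym x≈y) x≈

  size-Graph : ∀ γ → HasSize (X ∣ Graph γ) m
  size-Graph γ = mkInverse
    (λ (_ , t , _) → t)
    (λ t → point γ t , t , X.refl)
    (λ { {_ , t , x≈} {_ , t′ , y≈} x≈y → proj₁ (D-injective (X.trans (X.sym x≈) (X.trans x≈y y≈))) })
    (λ { ≡.refl → X.refl })
    (λ _ → ≡.refl)
    (λ (_ , _ , x≈) → X.sym x≈)

  -- One inclusion suffices, since both graphs have a point over every `t`: the point of `γ` over
  -- `t` lies in the graph of `δ` over some `t′`, and `D-injective` yields `t′ ≡ t` along with the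
  -- other two equalities.
  Graph-injective : ∀ {γ δ} → Graph γ ⊆ Graph δ → Setoid._≈_ Codes γ δ
  Graph-injective {γ} {δ} γ⊆δ = (λ t → proj₂ (proj₂ (agree t))) , (λ t → proj₁ (proj₂ (agree t)))
    where
    agree : ∀ t → t ≡ t × proj₂ γ ⟨$⟩ʳ t ≡ proj₂ δ ⟨$⟩ʳ t × proj₁ γ t ≡ proj₁ δ t
    agree t with γ⊆δ (t , X.refl)
    ... | t′ , eq with D-injective eq
    ...   | ≡.refl , s≡ , i≡ = ≡.refl , s≡ , i≡

  Graph-cong : ∀ {γ δ} → Setoid._≈_ Codes γ δ → Graph γ ⊆ Graph δ
  Graph-cong (f≗g , σ≈τ) (t , x≈) = t , X.trans x≈ (D-cong ≡.refl (σ≈τ t) (f≗g t))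

  -- Number the `m` members of `S`. Independence makes the first and the second parameter injective
  -- functions of the number, hence permutations of `Fin m`. The number can therefore be recovered
  -- from the first parameter, and the other two become functions of it.
  independent⇒Graph : {S : Pred X.Carrier p} → S Respects _≈_ → HasSize (X ∣ S) m →
    (∀ {x} → x ∈ S → ∃[ t ] ∃[ s ] ∃[ i ] x ≈ D t s i) →
    (∀ {t s i t′ s′ i′} → D t s i ∈ S → D t′ s′ i′ ∈ S →
       ¬ (t ≡ t′ × s ≡ s′ × i ≡ i′) → t ≢ t′ × s ≢ s′) →
    ∃[ γ ] S ≐ Graph γ
  independent⇒Graph {S = S} resp e cover indep = (f , σ) , S⊆Graph , Graph⊆S
    where
    open Enumeration e
    x : Fin m → X.Carrier
    x j = proj₁ (element j)
    t s : Fin m → Fin m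
    t j = proj₁ (cover (proj₂ (element j)))
    s j = proj₁ (proj₂ (cover (proj₂ (element j))))
    i : Fin m → Fin n
    i j = proj₁ (proj₂ (proj₂ (cover (proj₂ (element j)))))
    x≈D : ∀ j → x j ≈ D (t j) (s j) (i j)
    x≈D j = proj₂ (proj₂ (proj₂ (cover (proj₂ (element j)))))
    D∈S : ∀ j → D (t j) (s j) (i j) ∈ S
    D∈S j = resp (x≈D j) (proj₂ (element j))
    distinct : ∀ {j k} → j ≢ k → t j ≢ t k × s j ≢ s k
    distinct {j} {k} j≢k = indep (D∈S j) (D∈S k) λ (t≡ , s≡ , i≡) →
      j≢k (element-injective (X.trans (x≈D j) (X.trans (D-cong t≡ s≡ i≡) (X.sym (x≈D k)))))
    t-perm s-perm σ : Permutation m m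
    -- Independence only refutes equality of parameters for different members; decidable equality in
    -- `Fin m` turns this into injectivity.
    t-perm = injective⇒permutation t λ {j} {k} eq →
      decidable-stable (j Fin.≟ k) λ j≢k → proj₁ (distinct j≢k) eq
    s-perm = injective⇒permutation s λ {j} {k} eq →
      decidable-stable (j Fin.≟ k) λ j≢k → proj₂ (distinct j≢k) eq
    -- The left factor of `∘ₚ` acts first: from a first parameter back to the number of its member,
    -- then on to the second parameter.
    σ = Perm.flip t-perm Perm.∘ₚ s-perm
    f : Fin m → Fin n
    f = i ∘ (t-perm ⟨$⟩ˡ_)
    S⊆Graph : S ⊆ Graph (f , σ)
    S⊆Graph {y} y∈S = t j , X.trans (X.sym (element-index (y , y∈S)))
      (X.trans (x≈D j) (D-cong ≡.refl (≡.cong s (≡.sym (Perm.inverseˡ t-perm))) (≡.cong i (≡.sym (Perm.inverseˡ t-perm)))))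
      where j = index (y , y∈S)
    Graph⊆S : Graph (f , σ) ⊆ S
    Graph⊆S (k , y≈) = resp (X.sym (X.trans y≈ (D-cong (≡.sym (Perm.inverseʳ t-perm)) ≡.refl ≡.refl)))
      (D∈S (t-perm ⟨$⟩ˡ k))

-- Finite fields

module FiniteField {c ℓ₁ ℓ₂} (K : HeytingField c ℓ₁ ℓ₂) where
  open HeytingField K using (_#_; #⇒invertible; tight; heytingCommutativeRing)
  open HCRProperties heytingCommutativeRing public
  commutativeRing : CommutativeRing c ℓ₁
  commutativeRing = record { isCommutativeRing = HeytingField.isCommutativeRing K }
  open CommutativeRing commutativeRing
  open Exp commutativeSemiring
  open GroupProperties +-group using (x≈y⇒x∙y⁻¹≈ε; x∙y⁻¹≈ε⇒x≈y)
  open ≈-Reasoning setoid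

  #⇒≉ : ∀ {x y} → x # y → ¬ x ≈ y
  #⇒≉ x#y x≈y = proj₂ (tight _ _) x≈y x#y

  inverse-of : ∀ {x} → x # 0# → ∃[ x⁻¹ ] x * x⁻¹ ≈ 1#
  inverse-of {x} x#0 with #⇒invertible x#0
  ... | x⁻¹ , _ , eq = x⁻¹ , trans (*-congʳ (sym (x-0≈x x))) eq

  unit⇒#0 : ∀ {x y} → x * y ≈ 1# → x # 0#
  unit⇒#0 {x} {y} xy≈1 = invertibleʳ⇒# (y , trans (*-congʳ (x-0≈x x)) xy≈1)

  *-cancelˡ-# : ∀ {x} y z → x # 0# → x * y ≈ x * z → y ≈ z
  *-cancelˡ-# {x} y z x#0 xy≈xz with inverse-of x#0
  ... | x⁻¹ , xx⁻¹≈1 = begin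
    y              ≈⟨ x⁻¹xy≈y y ⟨
    x⁻¹ * (x * y)  ≈⟨ *-congˡ xy≈xz ⟩
    x⁻¹ * (x * z)  ≈⟨ x⁻¹xy≈y z ⟩
    z              ∎
    where
    x⁻¹xy≈y : ∀ y → x⁻¹ * (x * y) ≈ y
    x⁻¹xy≈y y = begin
      x⁻¹ * (x * y)  ≈⟨ *-assoc x⁻¹ x y ⟨
      x⁻¹ * x * y    ≈⟨ *-congʳ (trans (*-comm x⁻¹ x) xx⁻¹≈1) ⟩
      1# * y         ≈⟨ *-identityˡ y ⟩
      y              ∎

  ^-#0 : ∀ {x} n → x # 0# → x ^ n # 0#
  ^-#0 zero    x#0 = 1#0
  ^-#0 (suc n) x#0 = x#0y#0→xy#0 x#0 (^-#0 n x#0)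

  1^n≈1 : ∀ n → 1# ^ n ≈ 1#
  1^n≈1 zero    = refl
  1^n≈1 (suc n) = trans (*-identityˡ _) (1^n≈1 n)

  module _ {N} (e : HasSize setoid (suc N)) where
    open Enumeration e using (≈-dec; search)

    -- An inverse can be searched for among finitely many elements. If there is none, `x` is not
    -- apart from zero, and tightness gives `x ≈ 0#`.
    ≉0⇒#0 : ∀ {x} → ¬ x ≈ 0# → x # 0#
    ≉0⇒#0 {x} x≉0 with search (λ y≈z → trans (*-congˡ (sym y≈z))) (λ y → ≈-dec (x * y) 1#)
    ... | yes (y , xy≈1) = unit⇒#0 xy≈1
    ... | no ¬unit = contradiction (proj₁ (tight _ _) (¬unit ∘ inverse-of)) x≉0

    ≉⇒-#0 : ∀ {x y} → ¬ x ≈ y → x - y # 0#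
    ≉⇒-#0 x≉y = ≉0⇒#0 (x≉y ∘ x∙y⁻¹≈ε⇒x≈y _ _)

    ≉⇒# : ∀ {x y} → ¬ x ≈ y → x # y
    ≉⇒# x≉y = invertibleʳ⇒# (inverse-of (≉⇒-#0 x≉y))

    units : HasSize (setoid ∣ (λ x → ¬ x ≈ 0#)) N
    units = size-without e 0#

    -- The product of all units is invariant under multiplication by x.
    fermat : ∀ {x} → x # 0# → x ^ N ≈ 1#
    fermat {x} x#0 = *-cancelˡ-# _ _ (∏-#0 unit unit#0) (begin
      product unit * x ^ N            ≈⟨ *-comm _ _ ⟩
      x ^ N * product unit            ≈⟨ *-congʳ (sum-replicate N) ⟨
      product {N} (λ _ → x) * product unit  ≈⟨ ∑-distrib-+ (λ _ → x) unit ⟨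
      product (λ i → x * unit i)      ≈⟨ sum-cong-≋ {N} (λ i → element-index (scaled i)) ⟨
      product (λ i → unit (shift i))  ≈⟨ sum-permute unit (injective⇒permutation shift shift-injective) ⟨
      product unit                    ≈⟨ *-identityʳ _ ⟨
      product unit * 1#               ∎)
      where
      open Sum *-commutativeMonoid renaming (sum to product)
      open Enumeration units
      unit : Fin N → Carrier
      unit = proj₁ ∘ element
      unit#0 : ∀ i → unit i # 0#
      unit#0 i = ≉0⇒#0 (proj₂ (element i))
      scaled : Fin N → Σ Carrier (λ y → ¬ y ≈ 0#)
      scaled i = x * unit i , #⇒≉ (x#0y#0→xy#0 x#0 (unit#0 i))
      shift : Fin N → Fin N
      shift = index ∘ scaled
      shift-injective : Injective _≡_ _≡_ shift
      shift-injective {i} {j} eq =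
        element-injective (*-cancelˡ-# _ _ x#0 (index-injective {scaled i} {scaled j} eq))
      ∏-#0 : ∀ {n} (f : Fin n → Carrier) → (∀ i → f i # 0#) → product f # 0#
      ∏-#0 {zero}  f f#0 = 1#0
      ∏-#0 {suc n} f f#0 = x#0y#0→xy#0 (f#0 0F) (∏-#0 (f ∘ suc) (f#0 ∘ suc))

-- The unitary group and the norm

module Norm {c ℓ₁ ℓ₂} (K : HeytingField c ℓ₁ ℓ₂) (q k : ℕ) (q≡2+2k : q ≡ 2 ℕ.+ k ℕ.* 2)
  (size-𝕂 : HasSize (GoodSets.𝕂 K q) (q ℕ.^ 2)) where

  open GoodSets K q
  open HeytingField K using (_#_)
  open FiniteField K
  open CommutativeRing commutativeRing
  open Exp commutativeSemiring
  open ≈-Reasoning setoid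

  -- These are q - 1 and q² - 1, written without truncated subtraction.
  r N : ℕ
  r = suc (k ℕ.* 2)
  N = r ℕ.* suc q

  size-𝕂′ : HasSize 𝕂 (suc N)
  size-𝕂′ = ≡.subst (HasSize 𝕂) (≡.trans (≡.cong (ℕ._^ 2) q≡2+2k) (≡.trans
      (solve 1 (λ r → (con 1 :+ r) :* ((con 1 :+ r) :* con 1) := con 1 :+ r :* (con 2 :+ r)) ≡.refl r)
      (≡.cong (λ n → suc (r ℕ.* suc n)) (≡.sym q≡2+2k))))
    size-𝕂
    where open +-*-Solver

  open Enumeration size-𝕂′ public using () renaming (≈-dec to _≟_)

  #0⇒^N≈1 : ∀ {x} → x # 0# → x ^ N ≈ 1#
  #0⇒^N≈1 = fermat size-𝕂′

  norm-cong : ∀ {x y} → x ≈ y → norm x ≈ norm y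
  norm-cong = ^-congˡ (suc q)

  norm-* : ∀ x y → norm (x * y) ≈ norm x * norm y
  norm-* x y = ^-distrib-* x y (suc q)

  norm-#0 : ∀ {x} → x # 0# → norm x # 0#
  norm-#0 = ^-#0 (suc q)

  -- Since q = 1 + r, the q-th power of `norm x` is `norm x` times x ^ ((q + 1) r), and (q + 1) r is
  -- the order of the multiplicative group.
  norm∈𝔽q∖0 : ∀ {x} → x # 0# → norm x ∈ 𝔽q∖0
  norm∈𝔽q∖0 {x} x#0 = (begin
    norm x ^ q                 ≈⟨ ^-congʳ (norm x) q≡2+2k ⟩
    norm x * norm x ^ r        ≈⟨ *-congˡ (^-assocʳ x (suc q) r) ⟩
    norm x * x ^ (suc q ℕ.* r) ≈⟨ *-congˡ (^-congʳ x (ℕ.*-comm (suc q) r)) ⟩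
    norm x * x ^ N             ≈⟨ *-congˡ (#0⇒^N≈1 x#0) ⟩
    norm x * 1#                ≈⟨ *-identityʳ _ ⟩
    norm x                     ∎) , norm-#0 x#0

  𝒰-resp : 𝒰 Respects _≈_
  𝒰-resp x≈y x∈𝒰 = trans (norm-cong (sym x≈y)) x∈𝒰

  𝒰-* : ∀ {u v} → u ∈ 𝒰 → v ∈ 𝒰 → u * v ∈ 𝒰
  𝒰-* {u} {v} u∈𝒰 v∈𝒰 = trans (norm-* u v) (trans (*-cong u∈𝒰 v∈𝒰) (*-identityˡ 1#))

  𝒰-^ : ∀ {u} n → u ∈ 𝒰 → u ^ n ∈ 𝒰
  𝒰-^ zero    u∈𝒰 = 1^n≈1 (suc q)
  𝒰-^ (suc n) u∈𝒰 = 𝒰-* u∈𝒰 (𝒰-^ n u∈𝒰)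

  𝒰⇒#0 : ∀ {u} → u ∈ 𝒰 → u # 0#
  𝒰⇒#0 = unit⇒#0

  -- 𝒰 has odd exponent q + 1, so squaring is invertible on it.
  √_ : Carrier → Carrier
  √ u = u ^ (2 ℕ.+ k)

  √-cong : ∀ {u v} → u ≈ v → √ u ≈ √ v
  √-cong = ^-congˡ (2 ℕ.+ k)

  -- Twice the exponent 2 + k is q + 2, and u ^ (q + 2) is u times u ^ (q + 1).
  √u*√u≈u : ∀ {u} → u ∈ 𝒰 → √ u * √ u ≈ u
  √u*√u≈u {u} u∈𝒰 = begin
    √ u * √ u                     ≈⟨ ^-homo-* u (2 ℕ.+ k) (2 ℕ.+ k) ⟨
    u ^ (2 ℕ.+ k ℕ.+ (2 ℕ.+ k))   ≈⟨ ^-congʳ u (solve 1 (λ k → con 2 :+ k :+ (con 2 :+ k) := con 4 :+ k :* con 2) ≡.refl k) ⟩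
    u ^ (4 ℕ.+ k ℕ.* 2)           ≈⟨ ^-congʳ u (≡.cong (2 ℕ.+_) q≡2+2k) ⟨
    u * u ^ suc q                 ≈⟨ *-congˡ u∈𝒰 ⟩
    u * 1#                        ≈⟨ *-identityʳ u ⟩
    u                             ∎
    where open +-*-Solver

  √[u*u]≈u : ∀ {u} → u ∈ 𝒰 → √ (u * u) ≈ u
  √[u*u]≈u {u} u∈𝒰 = trans (^-distrib-* u u (2 ℕ.+ k)) (√u*√u≈u u∈𝒰)

  ω : Carrier → Carrier
  ω α = α ^ r

  ω-cong : ∀ {α β} → α ≈ β → ω α ≈ ω β
  ω-cong = ^-congˡ r

  ω∈𝒰 : ∀ {α} → α # 0# → ω α ∈ 𝒰
  ω∈𝒰 {α} α#0 = trans (^-assocʳ α r (suc q)) (#0⇒^N≈1 α#0)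

  ^q≈*ω : ∀ α → α ^ q ≈ α * ω α
  ^q≈*ω α = ^-congʳ α q≡2+2k

  -- Sizes of `ℐ` and `𝒰` by counting norms

  module _ {p r′} (Λ : Subset 𝕂 p) (Λ-norms : IsNormSystem (members Λ))
           (A : Subset 𝕂 r′) (A-half : IsHalfSystem (members A)) where
    private
      module Λ = IsNormSystem Λ-norms
      module A = IsHalfSystem A-half

    -- The contrapositive of `distinct-norms`, available because equality in a finite field is
    -- decidable and its negation gives apartness.
    Λ-norm-injective : ∀ {α β} → α ∈ members Λ → β ∈ members Λ → norm α ≈ norm β → α ≈ β
    Λ-norm-injective {α} {β} α∈Λ β∈Λ eq = decidable-stable (α ≟ β) λ α≉β →
      #⇒≉ (Λ.distinct-norms α∈Λ β∈Λ (≉⇒# size-𝕂′ α≉β)) eq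

    size-A : HasSize (𝕂 ∣ members A) k
    size-A = ≡.subst (HasSize _) (≡.trans (≡.cong (λ n → (n ∸ 2) / 2) q≡2+2k) (ℕ.m*n/n≡m k 2)) A.size

    size-Λ : HasSize (𝕂 ∣ members Λ) r
    size-Λ = ≡.subst (HasSize _) (≡.cong (_∸ 1) q≡2+2k) Λ.size

    private
      module EA = Enumeration size-A
      module EΛ = Enumeration size-Λ

    -- Bounds the number of elements of `𝔽q∖0` by 1 + k + k. An element of `Inverses` is coded by
    -- the member of `A` that it inverts. The code may vary with the membership proof; injectivity
    -- up to `≈` is what gives the bound.
    half-code : ∀ {x} → x ≈ 1# ⊎ x ∈ members A ⊎ x ∈ Inverses (members A) → Fin 1 ⊎ Fin k ⊎ Fin k
    half-code (inj₁ _)                    = inj₁ 0F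
    half-code (inj₂ (inj₁ x∈A))           = inj₂ (inj₁ (EA.index (_ , x∈A)))
    half-code (inj₂ (inj₂ (a , a∈A , _))) = inj₂ (inj₂ (EA.index (a , a∈A)))

    half-code-injective : ∀ {x y} x∈ y∈ → half-code {x} x∈ ≡ half-code {y} y∈ → x ≈ y
    half-code-injective (inj₁ x≈1) (inj₁ y≈1) _ = trans x≈1 (sym y≈1)
    half-code-injective (inj₂ (inj₁ x∈A)) (inj₂ (inj₁ y∈A)) eq =
      EA.index-injective {_ , x∈A} {_ , y∈A} (inj₁-injective (inj₂-injective eq))
    half-code-injective {x} {y} (inj₂ (inj₂ (a , a∈A , xa≈1))) (inj₂ (inj₂ (b , b∈A , yb≈1))) eq =
      *-cancelˡ-# x y (unit⇒#0 (trans (*-comm a x) xa≈1)) (begin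
        a * x  ≈⟨ *-comm a x ⟩
        x * a  ≈⟨ xa≈1 ⟩
        1#     ≈⟨ yb≈1 ⟨
        y * b  ≈⟨ *-comm y b ⟩
        b * y  ≈⟨ *-congʳ (EA.index-injective {a , a∈A} {b , b∈A} (inj₂-injective (inj₂-injective eq))) ⟨
        a * y  ∎)
    half-code-injective (inj₁ _) (inj₂ (inj₁ _)) ()
    half-code-injective (inj₁ _) (inj₂ (inj₂ _)) ()
    half-code-injective (inj₂ (inj₁ _)) (inj₁ _) ()
    half-code-injective (inj₂ (inj₂ _)) (inj₁ _) ()
    half-code-injective (inj₂ (inj₁ _)) (inj₂ (inj₂ _)) ()
    half-code-injective (inj₂ (inj₂ _)) (inj₂ (inj₁ _)) ()

    1+k+k≡r : 1 ℕ.+ (k ℕ.+ k) ≡ r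
    1+k+k≡r = solve 1 (λ k → con 1 :+ (k :+ k) := con 1 :+ k :* con 2) ≡.refl k
      where open +-*-Solver

    𝔽q∖0-index : ∀ {x} → x ∈ 𝔽q∖0 → Fin r
    𝔽q∖0-index x∈ = ≡.subst Fin 1+k+k≡r (Fin.join 1 (k ℕ.+ k) (map₂ (Fin.join k k) (half-code (Equivalence.from (A.union _) x∈))))

    𝔽q∖0-index-injective : ∀ {x y} (x∈ : x ∈ 𝔽q∖0) (y∈ : y ∈ 𝔽q∖0) → 𝔽q∖0-index x∈ ≡ 𝔽q∖0-index y∈ → x ≈ y
    𝔽q∖0-index-injective x∈ y∈ eq = half-code-injective (Equivalence.from (A.union _) x∈) (Equivalence.from (A.union _) y∈)
      (map₂-injective (join-injective k k) (join-injective 1 (k ℕ.+ k) (≡.subst-injective 1+k+k≡r eq)))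
      where
      join-injective : ∀ m n → Injective _≡_ _≡_ (Fin.join m n)
      join-injective m n {s} {t} eq =
        ≡.trans (≡.sym (Fin.splitAt-join m n s)) (≡.trans (≡.cong (Fin.splitAt m) eq) (Fin.splitAt-join m n t))
      map₂-injective : ∀ {a b c} {X : Set a} {Y : Set b} {Z : Set c} {f : Y → Z} →
                       Injective _≡_ _≡_ f → Injective _≡_ _≡_ (map₂ {A = X} f)
      map₂-injective f-inj {inj₁ _} {inj₁ _} ≡.refl = ≡.refl
      map₂-injective f-inj {inj₂ _} {inj₂ _} eq     = ≡.cong inj₂ (f-inj (inj₂-injective eq))

    element∈𝔽q∖0 : ∀ i → norm (proj₁ (EΛ.element i)) ∈ 𝔽q∖0
    element∈𝔽q∖0 i = norm∈𝔽q∖0 (Λ.nonzero (proj₂ (EΛ.element i)))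

    -- The norm on `Λ`, read through the numbering of `Λ` and the code of `𝔽q∖0`. As a self-map of
    -- `Fin r` it is surjective once injective, so every element of `𝔽q∖0` is the norm of a member
    -- of `Λ`.
    norm-index : Fin r → Fin r
    norm-index i = 𝔽q∖0-index (element∈𝔽q∖0 i)

    norm-index-injective : Injective _≡_ _≡_ norm-index
    norm-index-injective {i} {j} eq = EΛ.element-injective
      (Λ-norm-injective (proj₂ (EΛ.element i)) (proj₂ (EΛ.element j))
        (𝔽q∖0-index-injective (element∈𝔽q∖0 i) (element∈𝔽q∖0 j) eq))

    norm-index-surjective : ∀ {y} (y∈ : y ∈ 𝔽q∖0) → ∃[ i ] norm-index i ≡ 𝔽q∖0-index y∈
    norm-index-surjective y∈ = injective⇒surjective {n = r} {f = norm-index}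
      (λ {i} {j} → norm-index-injective {i} {j}) (𝔽q∖0-index y∈)

    abstract
      norm-surjective : ∀ {y} → y ∈ 𝔽q∖0 → ∃[ α ] α ∈ members Λ × norm α ≈ y
      norm-surjective {y} y∈ = representative (norm-index-surjective y∈)
        where
        representative : ∃[ i ] norm-index i ≡ 𝔽q∖0-index y∈ → ∃[ α ] α ∈ members Λ × norm α ≈ y
        representative (i , eq) = proj₁ (EΛ.element i) , proj₂ (EΛ.element i) ,
          𝔽q∖0-index-injective (element∈𝔽q∖0 i) y∈ eq

    A⊆𝔽q∖0 : members A ⊆ 𝔽q∖0
    A⊆𝔽q∖0 a∈A = Equivalence.to (A.union _) (inj₂ (inj₁ a∈A))

    -- The map is the norm: injective already on `Λ`, and onto `A` because `A` lies in `𝔽q∖0`, all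
    -- of whose elements are norms from `Λ`.
    ℐ↔A : Inverse (𝕂 ∣ ℐ (members Λ) (members A)) (𝕂 ∣ members A)
    ℐ↔A = bijective⇒Inverse (λ (α , _ , Nα∈A) → norm α , Nα∈A) norm-cong
      (λ { {_ , α∈Λ , _} {_ , β∈Λ , _} → Λ-norm-injective α∈Λ β∈Λ })
      (λ (a , a∈A) → let α , α∈Λ , Nα≈a = norm-surjective (A⊆𝔽q∖0 a∈A)
                     in (α , α∈Λ , respects A (sym Nα≈a) a∈A) , Nα≈a)

    size-ℐ : HasSize (𝕂 ∣ ℐ (members Λ) (members A)) k
    size-ℐ = size-resp ℐ↔A size-A

    norm-*𝒰 : ∀ α {u} → u ∈ 𝒰 → norm (α * u) ≈ norm α
    norm-*𝒰 α {u} u∈𝒰 = trans (norm-* α u) (trans (*-congˡ u∈𝒰) (*-identityʳ (norm α)))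

    -- Taking norms removes the unitary factors, so `α` and `β` have equal norms and agree;
    -- cancelling them leaves `u ≈ v`.
    polar-unique : ∀ {α u β v} → α ∈ members Λ → β ∈ members Λ → u ∈ 𝒰 → v ∈ 𝒰 →
                   α * u ≈ β * v → α ≈ β × u ≈ v
    polar-unique {α} {u} {β} {v} α∈Λ β∈Λ u∈𝒰 v∈𝒰 eq =
      α≈β , *-cancelˡ-# u v (Λ.nonzero α∈Λ) (trans eq (*-congʳ (sym α≈β)))
      where
      α≈β : α ≈ β
      α≈β = Λ-norm-injective α∈Λ β∈Λ (begin
        norm α        ≈⟨ norm-*𝒰 α u∈𝒰 ⟨
        norm (α * u)  ≈⟨ norm-cong eq ⟩
        norm (β * v)  ≈⟨ norm-*𝒰 β v∈𝒰 ⟩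
        norm β        ∎)

    NonZero : Setoid (c L.⊔ ℓ₁) ℓ₁
    NonZero = 𝕂 ∣ (λ x → ¬ x ≈ 0#)

    Polar : Setoid (c L.⊔ p L.⊔ ℓ₁) ℓ₁
    Polar = (𝕂 ∣ members Λ) ×ₛ (𝕂 ∣ 𝒰)

    fromPolar : Setoid.Carrier Polar → Setoid.Carrier NonZero
    fromPolar ((α , α∈Λ) , (u , u∈𝒰)) = α * u , #⇒≉ (x#0y#0→xy#0 (Λ.nonzero α∈Λ) (𝒰⇒#0 u∈𝒰))

    fromPolar-injective : Injective (Setoid._≈_ Polar) (Setoid._≈_ NonZero) fromPolar
    fromPolar-injective {(_ , α∈Λ) , (_ , u∈𝒰)} {(_ , β∈Λ) , (_ , v∈𝒰)} = polar-unique α∈Λ β∈Λ u∈𝒰 v∈𝒰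

    -- Take `α` in `Λ` with the same norm as `x`; then x / α has norm 1.
    fromPolar-surjective : ∀ x → ∃[ αu ] Setoid._≈_ NonZero (fromPolar αu) x
    fromPolar-surjective (x , x≉0) = ((α , α∈Λ) , (α⁻¹ * x , u∈𝒰)) , αu≈x
      where
      x#0 : x # 0#
      x#0 = ≉0⇒#0 size-𝕂′ x≉0
      rep : ∃[ α ] α ∈ members Λ × norm α ≈ norm x
      rep = norm-surjective (norm∈𝔽q∖0 x#0)
      α : Carrier
      α = proj₁ rep
      α∈Λ : α ∈ members Λ
      α∈Λ = proj₁ (proj₂ rep)
      inv : ∃[ α⁻¹ ] α * α⁻¹ ≈ 1#
      inv = inverse-of (Λ.nonzero α∈Λ)
      α⁻¹ : Carrier
      α⁻¹ = proj₁ inv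
      αu≈x : α * (α⁻¹ * x) ≈ x
      αu≈x = trans (sym (*-assoc α α⁻¹ x)) (trans (*-congʳ (proj₂ inv)) (*-identityˡ x))
      u∈𝒰 : α⁻¹ * x ∈ 𝒰
      u∈𝒰 = *-cancelˡ-# _ _ (norm-#0 (Λ.nonzero α∈Λ)) (begin
        norm α * norm (α⁻¹ * x)  ≈⟨ norm-* α (α⁻¹ * x) ⟨
        norm (α * (α⁻¹ * x))     ≈⟨ norm-cong αu≈x ⟩
        norm x                   ≈⟨ proj₂ (proj₂ rep) ⟨
        norm α                   ≈⟨ *-identityʳ _ ⟨
        norm α * 1#              ∎)

    polar : Inverse Polar NonZero
    polar = bijective⇒Inverse fromPolar (λ (α≈ , u≈) → *-cong α≈ u≈)
      (λ {αu} {βv} → fromPolar-injective {αu} {βv}) fromPolar-surjective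

    abstract
      -- `𝒰` is decidable, so it has some size m. The polar bijection gives r m = N = r (q + 1), and
      -- `r` is a successor, so it cancels.
      size-𝒰 : HasSize (𝕂 ∣ 𝒰) (suc q)
      size-𝒰 = ≡.subst (HasSize (𝕂 ∣ 𝒰)) (ℕ.*-cancelˡ-≡ (proj₁ counted) (suc q) r
        (size-unique (size-× size-Λ (proj₂ counted)) (size-resp polar (units size-𝕂′)))) (proj₂ counted)
        where
        counted : ∃[ m ] HasSize (𝕂 ∣ 𝒰) m
        counted = size-filter size-𝕂′ 𝒰-resp (λ u → norm u ≟ 1#)

-- Coordinates on triples and the count

module Counting {c ℓ₁ ℓ₂ p r′} (K : HeytingField c ℓ₁ ℓ₂) (q k : ℕ) (q≡2+2k : q ≡ 2 ℕ.+ k ℕ.* 2)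
  (size-𝕂 : HasSize (GoodSets.𝕂 K q) (q ℕ.^ 2))
  (Λ : Subset (GoodSets.𝕂 K q) p) (Λ-norms : GoodSets.IsNormSystem K q (members Λ))
  (A : Subset (GoodSets.𝕂 K q) r′) (A-half : GoodSets.IsHalfSystem K q (members A)) where

  open GoodSets K q
  open HeytingField K using (_#_)
  open FiniteField K
  open Norm K q k q≡2+2k size-𝕂
  open CommutativeRing commutativeRing
  open Exp commutativeSemiring
  open ≈-Reasoning setoid
  open GroupProperties +-group using (x≈y⇒x∙y⁻¹≈ε; ⁻¹-injective)
  
  private
    module CM = CommutativeMonoidSolver *-commutativeMonoid
    module Λ = IsNormSystem Λ-norms

  Ratio : Carrier → Carrier → Carrier
  Ratio u v = u * v ^ q

  Twist : Carrier → Carrier → Carrier → Carrier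
  Twist α u v = Ratio (u * v) (ω α)

  Ratio-cong : ∀ {u v u′ v′} → u ≈ u′ → v ≈ v′ → Ratio u v ≈ Ratio u′ v′
  Ratio-cong u≈ v≈ = *-cong u≈ (^-congˡ q v≈)

  Twist-cong : ∀ {α u v α′ u′ v′} → α ≈ α′ → u ≈ u′ → v ≈ v′ → Twist α u v ≈ Twist α′ u′ v′
  Twist-cong α≈ u≈ v≈ = Ratio-cong (*-cong u≈ v≈) (ω-cong α≈)

  -- On 𝒰 the map v ↦ v ^ q is inversion.
  Ratio* : ∀ u {v} → v ∈ 𝒰 → Ratio u v * v ≈ u
  Ratio* u {v} v∈𝒰 = begin
    u * v ^ q * v    ≈⟨ CM.solve 3 (λ u v v̄ → (u CM.⊕ v̄) CM.⊕ v CM.⊜ u CM.⊕ (v CM.⊕ v̄)) refl u v (v ^ q) ⟩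
    u * norm v       ≈⟨ *-congˡ v∈𝒰 ⟩
    u * 1#           ≈⟨ *-identityʳ u ⟩
    u                ∎

  cancel-Ratio : ∀ {x y v} → v ∈ 𝒰 → x * v ≈ y → x ≈ Ratio y v
  cancel-Ratio {x} {y} {v} v∈𝒰 xv≈y =
    *-cancelˡ-# x (Ratio y v) (𝒰⇒#0 v∈𝒰) (begin
      v * x          ≈⟨ *-comm v x ⟩
      x * v          ≈⟨ xv≈y ⟩
      y              ≈⟨ Ratio* y v∈𝒰 ⟨
      Ratio y v * v  ≈⟨ *-comm _ v ⟩
      v * Ratio y v  ∎)

  𝒰-Ratio : ∀ {u v} → u ∈ 𝒰 → v ∈ 𝒰 → Ratio u v ∈ 𝒰
  𝒰-Ratio u∈𝒰 v∈𝒰 = 𝒰-* u∈𝒰 (𝒰-^ q v∈𝒰)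

  -- Cross-multiplication. The equation on the right is the one that the first goodness condition
  -- forbids.
  Ratio≈⇔cross : ∀ {u v u′ v′} → v ∈ 𝒰 → v′ ∈ 𝒰 → Ratio u v ≈ Ratio u′ v′ ⇔ u * v′ ≈ v * u′
  Ratio≈⇔cross {u} {v} {u′} {v′} v∈𝒰 v′∈𝒰 = mk⇔
    (λ eq → begin
      u * v′                ≈⟨ *-congʳ (Ratio* u v∈𝒰) ⟨
      Ratio u v * v * v′    ≈⟨ *-congʳ (*-congʳ eq) ⟩
      Ratio u′ v′ * v * v′  ≈⟨ CM.solve 3 (λ x v v′ → (x CM.⊕ v) CM.⊕ v′ CM.⊜ v CM.⊕ (x CM.⊕ v′)) refl (Ratio u′ v′) v v′ ⟩
      v * (Ratio u′ v′ * v′) ≈⟨ *-congˡ (Ratio* u′ v′∈𝒰) ⟩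
      v * u′                ∎)
    (λ eq → cancel-Ratio v′∈𝒰 (*-cancelˡ-# _ _ (𝒰⇒#0 v∈𝒰) (begin
      v * (Ratio u v * v′)  ≈⟨ CM.solve 3 (λ x v v′ → v CM.⊕ (x CM.⊕ v′) CM.⊜ (x CM.⊕ v) CM.⊕ v′) refl (Ratio u v) v v′ ⟩
      Ratio u v * v * v′    ≈⟨ *-congʳ (Ratio* u v∈𝒰) ⟩
      u * v′                ≈⟨ eq ⟩
      v * u′                ∎)))

  Triples : Setoid (c L.⊔ ℓ₁ L.⊔ p L.⊔ r′) ℓ₁
  Triples = (𝕂 ∣ ℐ (members Λ) (members A)) ×ₛ ((𝕂 ∣ 𝒰) ×ₛ (𝕂 ∣ 𝒰))

  ℐ#0 : ∀ {α} → α ∈ ℐ (members Λ) (members A) → α # 0#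
  ℐ#0 (α∈Λ , _) = Λ.nonzero α∈Λ

  -- Substituting α ^ q = α ω(α) and β ^ q = β ω(β), both sides of the equation on the right acquire
  -- the factor α β. Without it the equation reads u ω(β) / v′ = ω(α) u′ / v. This and equality of
  -- twists both cross-multiply to u v ω(β) = ω(α) u′ v′.
  Twist≈⇔ : ∀ {α u v β u′ v′} → α # 0# → u ∈ 𝒰 → v ∈ 𝒰 → β # 0# → u′ ∈ 𝒰 → v′ ∈ 𝒰 →
    Twist α u v ≈ Twist β u′ v′ ⇔ α * u * (β * v′) ^ q ≈ (α * v) ^ q * (β * u′)
  Twist≈⇔ {α} {u} {v} {β} {u′} {v′} α#0 u∈𝒰 v∈𝒰 β#0 u′∈𝒰 v′∈𝒰 = mk⇔
    (λ eq → begin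
      α * u * (β * v′) ^ q             ≈⟨ lhs ⟩
      α * β * Ratio (u * ω β) v′       ≈⟨ *-congˡ (from cross (rearrange (to twist-cross eq))) ⟩
      α * β * Ratio (ω α * u′) v       ≈⟨ rhs ⟨
      (α * v) ^ q * (β * u′)           ∎)
    (λ eq → from twist-cross (rearrange⁻¹ (to cross
      (*-cancelˡ-# _ _ (x#0y#0→xy#0 α#0 β#0) (trans (sym lhs) (trans eq rhs))))))
    where
    open Equivalence using (to; from)
    twist-cross : Twist α u v ≈ Twist β u′ v′ ⇔ u * v * ω β ≈ ω α * (u′ * v′)
    twist-cross = Ratio≈⇔cross (ω∈𝒰 α#0) (ω∈𝒰 β#0)
    cross : Ratio (u * ω β) v′ ≈ Ratio (ω α * u′) v ⇔ u * ω β * v ≈ v′ * (ω α * u′)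
    cross = Ratio≈⇔cross v′∈𝒰 v∈𝒰
    open CM using (solve; _⊕_; _⊜_)
    lhs : α * u * (β * v′) ^ q ≈ α * β * Ratio (u * ω β) v′
    lhs = begin
      α * u * (β * v′) ^ q         ≈⟨ *-congˡ (^-distrib-* β v′ q) ⟩
      α * u * (β ^ q * v′ ^ q)     ≈⟨ *-congˡ (*-congʳ (^q≈*ω β)) ⟩
      α * u * (β * ω β * v′ ^ q)   ≈⟨ solve 5 (λ α u β w v → (α ⊕ u) ⊕ ((β ⊕ w) ⊕ v) ⊜ (α ⊕ β) ⊕ ((u ⊕ w) ⊕ v)) refl α u β (ω β) (v′ ^ q) ⟩
      α * β * (u * ω β * v′ ^ q)   ∎
    rhs : (α * v) ^ q * (β * u′) ≈ α * β * Ratio (ω α * u′) v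
    rhs = begin
      (α * v) ^ q * (β * u′)       ≈⟨ *-congʳ (^-distrib-* α v q) ⟩
      α ^ q * v ^ q * (β * u′)     ≈⟨ *-congʳ (*-congʳ (^q≈*ω α)) ⟩
      α * ω α * v ^ q * (β * u′)   ≈⟨ solve 5 (λ α u β w v → ((α ⊕ w) ⊕ v) ⊕ (β ⊕ u) ⊜ (α ⊕ β) ⊕ ((w ⊕ u) ⊕ v)) refl α u′ β (ω α) (v ^ q) ⟩
      α * β * (ω α * u′ * v ^ q)   ∎
    rearrange : u * v * ω β ≈ ω α * (u′ * v′) → u * ω β * v ≈ v′ * (ω α * u′)
    rearrange eq = begin
      u * ω β * v      ≈⟨ solve 3 (λ u v w → (u ⊕ w) ⊕ v ⊜ (u ⊕ v) ⊕ w) refl u v (ω β) ⟩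
      u * v * ω β      ≈⟨ eq ⟩
      ω α * (u′ * v′)  ≈⟨ solve 3 (λ u v w → w ⊕ (u ⊕ v) ⊜ v ⊕ (w ⊕ u)) refl u′ v′ (ω α) ⟩
      v′ * (ω α * u′)  ∎
    rearrange⁻¹ : u * ω β * v ≈ v′ * (ω α * u′) → u * v * ω β ≈ ω α * (u′ * v′)
    rearrange⁻¹ eq = begin
      u * v * ω β      ≈⟨ solve 3 (λ u v w → (u ⊕ w) ⊕ v ⊜ (u ⊕ v) ⊕ w) refl u v (ω β) ⟨
      u * ω β * v      ≈⟨ eq ⟩
      v′ * (ω α * u′)  ≈⟨ solve 3 (λ u v w → w ⊕ (u ⊕ v) ⊜ v ⊕ (w ⊕ u)) refl u′ v′ (ω α) ⟨
      ω α * (u′ * v′)  ∎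

  Triple : Set (c L.⊔ ℓ₁ L.⊔ p L.⊔ r′)
  Triple = Setoid.Carrier Triples

  open Setoid Triples using () renaming (_≈_ to _≈ₜ_)

  ratio twist : Triple → Carrier
  ratio (_ , (u , _) , (v , _)) = Ratio u v
  twist ((α , _) , (u , _) , (v , _)) = Twist α u v

  ratio-cong : ∀ {τ τ′} → τ ≈ₜ τ′ → ratio τ ≈ ratio τ′
  ratio-cong (_ , u≈ , v≈) = Ratio-cong u≈ v≈

  twist-cong : ∀ {τ τ′} → τ ≈ₜ τ′ → twist τ ≈ twist τ′
  twist-cong (α≈ , u≈ , v≈) = Twist-cong α≈ u≈ v≈

  -- This is u² = (u / v) (u v). As `u` is the square root of its own square in `𝒰`, it lets `u` be
  -- recovered from `α`, the ratio and the twist.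
  u*u≈ : ∀ {α} u {v} → α # 0# → v ∈ 𝒰 → u * u ≈ Ratio u v * Twist α u v * ω α
  u*u≈ {α} u {v} α#0 v∈𝒰 = begin
    u * u                        ≈⟨ *-congʳ (Ratio* u v∈𝒰) ⟨
    Ratio u v * v * u            ≈⟨ CM.solve 3 (λ x v u → (x CM.⊕ v) CM.⊕ u CM.⊜ x CM.⊕ (u CM.⊕ v)) refl (Ratio u v) v u ⟩
    Ratio u v * (u * v)          ≈⟨ *-congˡ (Ratio* (u * v) (ω∈𝒰 α#0)) ⟨
    Ratio u v * (Twist α u v * ω α)  ≈⟨ *-assoc _ _ _ ⟨
    Ratio u v * Twist α u v * ω α    ∎

  parameters : Triple → Triple
  parameters τ@((α , α∈ℐ) , (u , u∈𝒰) , (v , v∈𝒰)) =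
    (α , α∈ℐ) , (ratio τ , 𝒰-Ratio u∈𝒰 v∈𝒰) , (twist τ , 𝒰-Ratio (𝒰-* u∈𝒰 v∈𝒰) (ω∈𝒰 (ℐ#0 α∈ℐ)))

  -- `α` is itself a parameter, `u` is determined through its square, and then v = u / t.
  parameters-injective : Injective _≈ₜ_ _≈ₜ_ parameters
  parameters-injective {(α , α∈ℐ) , (u , u∈𝒰) , (v , v∈𝒰)} {(β , β∈ℐ) , (u′ , u′∈𝒰) , (v′ , v′∈𝒰)} (α≈ , t≈ , s≈) =
    α≈ , u≈ , *-cancelˡ-# v v′ (𝒰⇒#0 (𝒰-Ratio u∈𝒰 v∈𝒰)) (begin
      Ratio u v * v    ≈⟨ Ratio* u v∈𝒰 ⟩
      u                ≈⟨ u≈ ⟩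
      u′               ≈⟨ Ratio* u′ v′∈𝒰 ⟨
      Ratio u′ v′ * v′ ≈⟨ *-congʳ t≈ ⟨
      Ratio u v * v′   ∎)
    where
    u≈ : u ≈ u′
    u≈ = begin
      u                                        ≈⟨ √[u*u]≈u u∈𝒰 ⟨
      √ (u * u)                                ≈⟨ √-cong (u*u≈ u (ℐ#0 α∈ℐ) v∈𝒰) ⟩
      √ (Ratio u v * Twist α u v * ω α)        ≈⟨ √-cong (*-cong (*-cong t≈ s≈) (ω-cong α≈)) ⟩
      √ (Ratio u′ v′ * Twist β u′ v′ * ω β)    ≈⟨ √-cong (u*u≈ u′ (ℐ#0 β∈ℐ) v′∈𝒰) ⟨
      √ (u′ * u′)                              ≈⟨ √[u*u]≈u u′∈𝒰 ⟩
      u′                                       ∎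

  parameters-surjective : ∀ τ → ∃[ τ′ ] parameters τ′ ≈ₜ τ
  parameters-surjective ((α , α∈ℐ) , (t , t∈𝒰) , (s , s∈𝒰)) =
    ((α , α∈ℐ) , (u , u∈𝒰) , (v , v∈𝒰)) , refl , sym (cancel-Ratio v∈𝒰 tv≈u) , sym (cancel-Ratio (ω∈𝒰 (ℐ#0 α∈ℐ)) sω≈uv)
    where
    u v : Carrier
    -- Both are forced: `u` must have square t s ω(α), and u / v must be `t`.
    u = √ (t * s * ω α)
    v = Ratio u t
    tsω∈𝒰 : t * s * ω α ∈ 𝒰
    tsω∈𝒰 = 𝒰-* (𝒰-* t∈𝒰 s∈𝒰) (ω∈𝒰 (ℐ#0 α∈ℐ))
    u∈𝒰 : u ∈ 𝒰
    u∈𝒰 = 𝒰-^ (2 ℕ.+ k) tsω∈𝒰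
    v∈𝒰 : v ∈ 𝒰
    v∈𝒰 = 𝒰-Ratio u∈𝒰 t∈𝒰
    tv≈u : t * v ≈ u
    tv≈u = trans (*-comm t v) (Ratio* u t∈𝒰)
    sω≈uv : s * ω α ≈ u * v
    -- After multiplication by `t` both sides equal u².
    sω≈uv = *-cancelˡ-# _ _ (𝒰⇒#0 t∈𝒰) (begin
      t * (s * ω α)  ≈⟨ *-assoc t s (ω α) ⟨
      t * s * ω α    ≈⟨ √u*√u≈u tsω∈𝒰 ⟨
      u * u          ≈⟨ *-congˡ tv≈u ⟨
      u * (t * v)    ≈⟨ CM.solve 3 (λ u t v → u CM.⊕ (t CM.⊕ v) CM.⊜ t CM.⊕ (u CM.⊕ v)) refl u t v ⟩
      t * (u * v)    ∎)

  -- From triples to pairs of a point and a plane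

  toPair : Triple → Setoid.Carrier Pair
  toPair ((α , _) , (u , _) , (v , _)) = pair α u v

  open Setoid Pair using () renaming (_≈_ to _≈ₚ_; trans to ≈ₚ-trans)

  P-injective : ∀ {x y} → Setoid._≈_ Point (P x) (P y) → x ≈ y
  P-injective {x} {y} (κ , _ , eq) = begin
    x            ≈⟨ eq 2F ⟩
    -- The first coordinates are both 1, so the scalar `κ` is 1; for planes the fourth coordinates
    -- do the same.
    κ * y        ≈⟨ *-congʳ (trans (eq 0F) (*-identityʳ κ)) ⟨
    1# * y       ≈⟨ *-identityˡ y ⟩
    y            ∎

  π-injective : ∀ {x y} → Setoid._≈_ Plane (π x) (π y) → x ≈ y
  π-injective {x} {y} (κ , _ , eq) = ⁻¹-injective (begin
    - x          ≈⟨ eq 1F ⟩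
    κ * - y      ≈⟨ *-congʳ (trans (eq 3F) (*-identityʳ κ)) ⟨
    1# * - y     ≈⟨ *-identityˡ (- y) ⟩
    - y          ∎)

  P-cong : ∀ {x y} → x ≈ y → Setoid._≈_ Point (P x) (P y)
  P-cong x≈y = 1# , 1#0 , λ where
    0F → sym (*-identityˡ 1#)
    1F → sym (*-identityˡ 0#)
    2F → trans x≈y (sym (*-identityˡ _))
    3F → sym (*-identityˡ 0#)

  π-cong : ∀ {x y} → x ≈ y → Setoid._≈_ Plane (π x) (π y)
  π-cong x≈y = 1# , 1#0 , λ where
    0F → sym (*-identityˡ 0#)
    1F → trans (-‿cong x≈y) (sym (*-identityˡ _))
    2F → sym (*-identityˡ 0#)
    3F → sym (*-identityˡ 1#)

  toPair-cong : ∀ {τ τ′} → τ ≈ₜ τ′ → toPair τ ≈ₚ toPair τ′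
  toPair-cong (α≈ , u≈ , v≈) = P-cong (*-cong α≈ u≈) , π-cong (*-cong α≈ v≈)

  -- The point determines α u, hence `α` and `u` by `polar-unique`; the plane determines α v, hence
  -- `v`.
  toPair-injective : ∀ {τ τ′} → toPair τ ≈ₚ toPair τ′ → τ ≈ₜ τ′
  toPair-injective {(α , α∈Λ , _) , (u , u∈𝒰) , _} {(β , β∈Λ , _) , (u′ , u′∈𝒰) , _} (P≈ , π≈) =
    let α≈ , u≈ = polar-unique Λ Λ-norms A A-half α∈Λ β∈Λ u∈𝒰 u′∈𝒰 (P-injective P≈) in
    α≈ , u≈ , *-cancelˡ-# _ _ (Λ.nonzero α∈Λ) (trans (π-injective π≈) (*-congʳ (sym α≈)))

  Separated : Triple → Triple → Set ℓ₂
  Separated ((α , _) , (u , _) , (v , _)) ((β , _) , (u′ , _) , (v′ , _)) =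
    (u * v′ - v * u′) # 0# × (α * u * (β * v′) ^ q - (α * v) ^ q * (β * u′)) # 0#

  -- A difference is apart from zero exactly when its two terms are unequal, the field being finite;
  -- the two cross-multiplied equations are then equality of ratios and equality of twists.
  Separated⇔ : ∀ {τ τ′} → Separated τ τ′ ⇔ (¬ ratio τ ≈ ratio τ′ × ¬ twist τ ≈ twist τ′)
  Separated⇔ {(α , α∈ℐ) , (u , u∈𝒰) , (v , v∈𝒰)} {(β , β∈ℐ) , (u′ , u′∈𝒰) , (v′ , v′∈𝒰)} = mk⇔
    (λ (d₁ , d₂) → #⇒≉ d₁ ∘ x≈y⇒x∙y⁻¹≈ε ∘ Equivalence.to ratio⇔
                 , #⇒≉ d₂ ∘ x≈y⇒x∙y⁻¹≈ε ∘ Equivalence.to twist⇔)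
    (λ (t≉ , s≉) → ≉⇒-#0 size-𝕂′ (t≉ ∘ Equivalence.from ratio⇔)
                 , ≉⇒-#0 size-𝕂′ (s≉ ∘ Equivalence.from twist⇔))
    where
    ratio⇔ = Ratio≈⇔cross {u} {v} {u′} {v′} v∈𝒰 v′∈𝒰
    twist⇔ = Twist≈⇔ {α} {u} {v} {β} {u′} {v′} (ℐ#0 α∈ℐ) u∈𝒰 v∈𝒰 (ℐ#0 β∈ℐ) u′∈𝒰 v′∈𝒰

  -- Numbered coordinates, and good sets as graphs

  private
    module EI = Enumeration (size-ℐ Λ Λ-norms A A-half)
    module EU = Enumeration (size-𝒰 Λ Λ-norms A A-half)

  abstract
    -- The inverse of `parameters`, read through numberings of `𝒰` and `ℐ`. The ratio comes first
    -- because good sets are to be graphs over it.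
    triple : Fin (suc q) → Fin (suc q) → Fin k → Triple
    triple t s i = proj₁ (parameters-surjective (EI.element i , EU.element t , EU.element s))

    triple-parameters : ∀ t s i → parameters (triple t s i) ≈ₜ (EI.element i , EU.element t , EU.element s)
    triple-parameters t s i = proj₂ (parameters-surjective (EI.element i , EU.element t , EU.element s))

  triple-surjective : ∀ τ → ∃[ t ] ∃[ s ] ∃[ i ] τ ≈ₜ triple t s i
  triple-surjective τ@(α , _ , _) = t , s , i ,
    parameters-injective {τ} {triple t s i}
      ( trans (sym (EI.element-index α)) (sym (proj₁ (triple-parameters t s i)))
      , trans (sym (EU.element-index (proj₁ (proj₂ (parameters τ))))) (sym (proj₁ (proj₂ (triple-parameters t s i))))
      , trans (sym (EU.element-index (proj₂ (proj₂ (parameters τ))))) (sym (proj₂ (proj₂ (triple-parameters t s i)))))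
    where
    i = EI.index α
    t = EU.index (proj₁ (proj₂ (parameters τ)))
    s = EU.index (proj₂ (proj₂ (parameters τ)))

  ratio-triple≈⇔ : ∀ {t s i t′ s′ i′} → ratio (triple t s i) ≈ ratio (triple t′ s′ i′) ⇔ t ≡ t′
  ratio-triple≈⇔ {t} {s} {i} {t′} {s′} {i′} = mk⇔
    (λ eq → EU.element-injective (trans (sym (at t s i)) (trans eq (at t′ s′ i′))))
    (λ { ≡.refl → trans (at t s i) (sym (at t s′ i′)) })
    where
    at : ∀ t s i → ratio (triple t s i) ≈ proj₁ (EU.element t)
    at t s i = proj₁ (proj₂ (triple-parameters t s i))

  twist-triple≈⇔ : ∀ {t s i t′ s′ i′} → twist (triple t s i) ≈ twist (triple t′ s′ i′) ⇔ s ≡ s′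
  twist-triple≈⇔ {t} {s} {i} {t′} {s′} {i′} = mk⇔
    (λ eq → EU.element-injective (trans (sym (at t s i)) (trans eq (at t′ s′ i′))))
    (λ { ≡.refl → trans (at t s i) (sym (at t′ s i′)) })
    where
    at : ∀ t s i → twist (triple t s i) ≈ proj₁ (EU.element s)
    at t s i = proj₂ (proj₂ (triple-parameters t s i))

  triple-injective : ∀ {t s i t′ s′ i′} → triple t s i ≈ₜ triple t′ s′ i′ → t ≡ t′ × s ≡ s′ × i ≡ i′
  triple-injective {t} {s} {i} {t′} {s′} {i′} eq =
      Equivalence.to (ratio-triple≈⇔ {t} {s} {i} {t′} {s′} {i′}) (ratio-cong {triple t s i} {triple t′ s′ i′} eq)
    , Equivalence.to (twist-triple≈⇔ {t} {s} {i} {t′} {s′} {i′}) (twist-cong {triple t s i} {triple t′ s′ i′} eq)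
    , EI.element-injective (trans (sym (proj₁ (triple-parameters t s i)))
        (trans (proj₁ eq) (proj₁ (triple-parameters t′ s′ i′))))

  D : Fin (suc q) → Fin (suc q) → Fin k → Setoid.Carrier Pair
  D t s i = toPair (triple t s i)

  D-injective : ∀ {t s i t′ s′ i′} → D t s i ≈ₚ D t′ s′ i′ → t ≡ t′ × s ≡ s′ × i ≡ i′
  D-injective {t} {s} {i} {t′} {s′} {i′} = triple-injective ∘ toPair-injective {triple t s i} {triple t′ s′ i′}

  open Graphs Pair D (λ {t} {s} {i} {t′} {s′} {i′} → D-injective {t} {s} {i} {t′} {s′} {i′})

  Goods : Setoid _ _
  Goods = GoodSetSetoid (members Λ) (members A)

  -- Different triples in a graph lie over different `t`, so their ratios differ; their twists
  -- differ because `σ` is injective.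
  graph-separated : ∀ γ {τ τ′} → toPair τ ∈ Graph γ → toPair τ′ ∈ Graph γ → ¬ τ ≈ₜ τ′ → Separated τ τ′
  graph-separated γ@(f , σ) {τ} {τ′} (t , τ≈) (t′ , τ′≈) τ≉τ′ = Equivalence.from (Separated⇔ {τ} {τ′})
    ( (λ eq → t≢t′ (Equivalence.to (ratio-triple≈⇔ {t} {σ ⟨$⟩ʳ t} {f t} {t′} {σ ⟨$⟩ʳ t′} {f t′})
        (trans (sym (ratio-cong {τ} {at t} τ≈ₜ)) (trans eq (ratio-cong {τ′} {at t′} τ′≈ₜ)))))
    , (λ eq → t≢t′ (Inverse-injective (Equivalence.to (twist-triple≈⇔ {t} {σ ⟨$⟩ʳ t} {f t} {t′} {σ ⟨$⟩ʳ t′} {f t′})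
        (trans (sym (twist-cong {τ} {at t} τ≈ₜ)) (trans eq (twist-cong {τ′} {at t′} τ′≈ₜ))))))
    )
    where
    at : Fin (suc q) → Triple
    at t = triple t (σ ⟨$⟩ʳ t) (f t)
    τ≈ₜ : τ ≈ₜ at t
    τ≈ₜ = toPair-injective {τ} {at t} τ≈
    τ′≈ₜ : τ′ ≈ₜ at t′
    τ′≈ₜ = toPair-injective {τ′} {at t′} τ′≈
    t≢t′ : t ≢ t′
    t≢t′ ≡.refl = τ≉τ′ (Setoid.trans Triples {τ} {at t} {τ′} τ≈ₜ (Setoid.sym Triples {τ′} {at t} τ′≈ₜ))
    Inverse-injective : ∀ {t t′} → σ ⟨$⟩ʳ t ≡ σ ⟨$⟩ʳ t′ → t ≡ t′
    Inverse-injective eq = ≡.trans (≡.sym (Perm.inverseˡ σ)) (≡.trans (≡.cong (σ ⟨$⟩ˡ_) eq) (Perm.inverseˡ σ))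

  graphGoodSet : Code → GoodSet (members Λ) (members A)
  graphGoodSet γ@(f , σ) = record
    { pairs = record { members = Graph γ ; respects = λ {x} {y} → Graph-resp γ {x} {y} }
    ; size  = size-Graph γ
    ; shape = λ (t , x≈) → let (α , α∈ℐ) , (u , u∈𝒰) , (v , v∈𝒰) = triple t (σ ⟨$⟩ʳ t) (f t)
                           in α , u , v , α∈ℐ , u∈𝒰 , v∈𝒰 , x≈
    ; good  = λ α∈ℐ u∈𝒰 v∈𝒰 β∈ℐ u′∈𝒰 v′∈𝒰 → graph-separated γ
        {(_ , α∈ℐ) , (_ , u∈𝒰) , (_ , v∈𝒰)} {(_ , β∈ℐ) , (_ , u′∈𝒰) , (_ , v′∈𝒰)}
    }

  -- Through `Separated⇔`, goodness becomes independence of the coordinates. A good set has q + 1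
  -- members, as many as there are ratios and twists, so the pigeonhole argument of
  -- `independent⇒Graph` applies.
  goodSet-isGraph : (G : GoodSet (members Λ) (members A)) → ∃[ γ ] Graph γ ≐ members (GoodSet.pairs G)
  goodSet-isGraph G = Product.map₂ Product.swap
    (independent⇒Graph {S = members pairs} (λ {x} {y} → respects pairs {x} {y}) size cover independent)
    where
    open GoodSet G
    cover : ∀ {x} → x ∈ members pairs → ∃[ t ] ∃[ s ] ∃[ i ] x ≈ₚ D t s i
    cover {x} x∈ =
      let α , u , v , α∈ℐ , u∈𝒰 , v∈𝒰 , x≈ = shape x∈
          τ = (α , α∈ℐ) , (u , u∈𝒰) , (v , v∈𝒰)
          t , s , i , τ≈ = triple-surjective τ
      in t , s , i , ≈ₚ-trans {x} {toPair τ} {D t s i} x≈ (toPair-cong {τ} {triple t s i} τ≈)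
    separated : ∀ {τ τ′} → toPair τ ∈ members pairs → toPair τ′ ∈ members pairs → ¬ τ ≈ₜ τ′ → Separated τ τ′
    separated {(_ , α∈ℐ) , (_ , u∈𝒰) , (_ , v∈𝒰)} {(_ , β∈ℐ) , (_ , u′∈𝒰) , (_ , v′∈𝒰)} =
      good α∈ℐ u∈𝒰 v∈𝒰 β∈ℐ u′∈𝒰 v′∈𝒰
    independent : ∀ {t s i t′ s′ i′} → D t s i ∈ members pairs → D t′ s′ i′ ∈ members pairs →
                  ¬ (t ≡ t′ × s ≡ s′ × i ≡ i′) → t ≢ t′ × s ≢ s′
    independent {t} {s} {i} {t′} {s′} {i′} D∈ D′∈ ¬eq =
      let r≉ , w≉ = Equivalence.to (Separated⇔ {τ} {τ′}) (separated {τ} {τ′} D∈ D′∈ (¬eq ∘ triple-injective))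
      in r≉ ∘ Equivalence.from (ratio-triple≈⇔ {t} {s} {i} {t′} {s′} {i′})
       , w≉ ∘ Equivalence.from (twist-triple≈⇔ {t} {s} {i} {t′} {s′} {i′})
      where
      τ τ′ : Triple
      τ  = triple t s i
      τ′ = triple t′ s′ i′

  goodSets : Inverse Codes Goods
  goodSets = bijective⇒Inverse graphGoodSet
    (λ {γ} {δ} γ≈δ → (λ {x} → Graph-cong {γ} {δ} γ≈δ {x}) , (λ {x} → Graph-cong {δ} {γ} (Setoid.sym Codes {γ} {δ} γ≈δ) {x}))
    (λ {γ} {δ} (γ⊆δ , _) → Graph-injective {γ} {δ} (λ {x} → γ⊆δ {x}))
    goodSet-isGraph

  size-goodSets : HasSize Goods (k ℕ.^ suc q ℕ.* suc q !)
  size-goodSets = size-resp (Symm.inverse goodSets) (size-× (size-→ (suc q) k) (size-Permutations (suc q)))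

-- Powers of two

2^h≡2+2k : ∀ h → 4 ≤ 2 ℕ.^ h → ∃[ k ] 2 ℕ.^ h ≡ 2 ℕ.+ k ℕ.* 2
2^h≡2+2k zero    (s≤s ())
-- The exponent is now h + 1, so k = 2 ^ h - 1; the predecessor is exact because 2 ^ h is nonzero.
2^h≡2+2k (suc h) _ = ℕ.pred (2 ℕ.^ h) , (begin
  2 ℕ.* 2 ℕ.^ h                   ≡⟨ ℕ.*-comm 2 (2 ℕ.^ h) ⟩
  2 ℕ.^ h ℕ.* 2                   ≡⟨ ≡.cong (ℕ._* 2) (ℕ.suc-pred (2 ℕ.^ h) {{ℕ.m^n≢0 2 h}}) ⟨
  suc (ℕ.pred (2 ℕ.^ h)) ℕ.* 2    ∎)
  where open ≡-Reasoning

open import Data.Nat.Base using (_*_; _^_)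

proposition4p5 : ∀ {c ℓ₁ ℓ₂ p r} (K : HeytingField c ℓ₁ ℓ₂) (q : ℕ) →
    let open GoodSets K q in
    4 ≤ q → (∃[ h ] q ≡ 2 ^ h) →
    HasSize 𝕂 (q ^ 2) →
    (Λ : Subset 𝕂 p) → IsNormSystem (members Λ) →
    (A : Subset 𝕂 r) → IsHalfSystem (members A) →
    ∃[ n ] HasSize (𝕂 ∣ ℐ (members Λ) (members A)) n
    × HasSize (GoodSetSetoid (members Λ) (members A)) (n ^ suc q * suc q !)
    × n ^ suc q * suc q ! ≡ ((q ∸ 2) / 2) ^ suc q * suc q !
proposition4p5 K q 4≤q (h , q≡2^h) size-𝕂 Λ Λ-norms A A-half =
  k , Norm.size-ℐ K q k q≡2+2k size-𝕂 Λ Λ-norms A A-half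
    , Counting.size-goodSets K q k q≡2+2k size-𝕂 Λ Λ-norms A A-half
    , ≡.cong (λ n → n ^ suc q * suc q !) (≡.sym [q∸2]/2≡k)
  where
  halved : ∃[ k ] 2 ^ h ≡ 2 ℕ.+ k * 2
  halved = 2^h≡2+2k h (≡.subst (4 ≤_) q≡2^h 4≤q)
  k : ℕ
  k = proj₁ halved
  q≡2+2k : q ≡ 2 ℕ.+ k * 2
  q≡2+2k = ≡.trans q≡2^h (proj₂ halved)
  [q∸2]/2≡k : (q ∸ 2) / 2 ≡ k
  [q∸2]/2≡k = ≡.trans (≡.cong (λ n → (n ∸ 2) / 2) q≡2+2k) (ℕ.m*n/n≡m k 2)
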